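{- Let $p>2$ be a prime and let $n$ be a positive integer satisfying one of the following conditions: (1) every prime $q$ dividing $n$ satisfies $\nu_p(\sigma(q^{\nu_q(n)})) \le \lfloor \log_p(q^{\nu_q(n)})\rfloor$; or (2) every prime $q$ dividing $n$ which satisfies $\nu_p(\sigma(q^{\nu_q(n)})) = \lceil \log_p(q^{\nu_q(n)})\rceil$ is less than $p$; or (3) there is a unique prime $q>p$ dividing $n$ such that $\nu_p(\sigma(q^{\nu_q(n)})) = \lceil \log_p(q^{\nu_q(n)})\rceil$. Then $$\nu_p(\sigma(n)) \le \lceil \log_p n\rceil.$$ Equality occurs if every prime factor $q$ of $n$ is a solution of the Ljunggren-Nagell equation $$\frac{q^{k+1}-1}{q-1} = p^s$$ for some $k, s \in \mathbb{N}$.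
   Context: For a prime $p$ and a positive integer $m$, $\nu_p(m)$ denotes the exponent of the highest power of $p$ dividing $m$. $\sigma(n)$ is the sum of the positive divisors of $n$. $\log_p$ is the logarithm to base $p$, and $\lfloor\cdot\rfloor$, $\lceil\cdot\rceil$ are the floor and ceiling functions.
   Formalization: In the equality clause k is taken to be ν_q(n), the exponent of q in n, instead of arbitrary; with arbitrary k the claim fails for p = 3, n = 4, q = 2, k = 1, where ν_3(σ(4)) = 0 but ⌈log_3 4⌉ = 2. -}

module Defs where

open import Data.Empty using (⊥-elim)
open import Data.List.Base using (filter; map; upTo)
open import Data.Nat.Base
open import Data.Nat.Divisibility using (_∣_; _∣?_; 1∣_; ∣⇒≤)
open import Data.Nat.DivMod using (_/_)
open import Data.Nat.ListAction using (sum)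
open import Data.Nat.Primality using (Prime; prime⇒nonTrivial)
open import Data.Nat.Properties
open import Data.Product.Base using (_×_; _,_)
open import Relation.Binary.PropositionalEquality
open import Relation.Nullary using (yes; no)
open import Relation.Unary using (Decidable)

private
  variable
    P : ℕ → Set

-- The greatest k ≤ b with P k (0 if there is none).
greatestUpTo : Decidable P → ℕ → ℕ
greatestUpTo P? zero    = zero
greatestUpTo P? (suc b) with P? (suc b)
... | yes _ = suc b
... | no  _ = greatestUpTo P? b

-- The least k ≤ b with P k (b if there is none).
leastUpTo : Decidable P → ℕ → ℕ
leastUpTo P? zero    = zero
leastUpTo P? (suc b) with P? zero
... | yes _ = zero
... | no  _ = suc (leastUpTo (λ k → P? (suc k)) b)

-- The search bound m below loses nothing: for p ≥ 2 and m ≥ 1 we have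
-- m < p ^ m, see ν-spec, ⌊log⌋-spec and ⌈log⌉-spec.

ν : ℕ → ℕ → ℕ
ν p m = greatestUpTo (λ k → (p ^ k) ∣? m) m

-- ⌊log_p m⌋ and ⌈log_p m⌉ for m ≥ 1, using that for an integer k,
-- k ≤ log_p m means p ^ k ≤ m and log_p m ≤ k means m ≤ p ^ k.
-- As log_p m ≥ 0, only k ∈ ℕ need be considered.

⌊log[_]_⌋ : ℕ → ℕ → ℕ
⌊log[ p ] m ⌋ = greatestUpTo (λ k → (p ^ k) ≤? m) m

⌈log[_]_⌉ : ℕ → ℕ → ℕ
⌈log[ p ] m ⌉ = leastUpTo (λ k → m ≤? (p ^ k)) m

σ : ℕ → ℕ
σ n = sum (filter (_∣? n) (map suc (upTo n)))

-- (q ^ (k + 1) - 1) / (q - 1) = p ^ s. The division of naturals is exact,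
-- because q - 1 divides q ^ (k + 1) - 1.
LjunggrenNagell : (p q k s : ℕ) → Prime q → Set
LjunggrenNagell p q k s q-prime = (q ^ suc k ∸ 1) / (q ∸ 1) ≡ p ^ s
  where
  instance
    q∸1≢0 : NonZero (q ∸ 1)
    q∸1≢0 = >-nonZero (m<n⇒0<n∸m (nonTrivial⇒n>1 q {{prime⇒nonTrivial q-prime}}))

greatestUpTo-holds : (P? : Decidable P) → P 0 → ∀ b → P (greatestUpTo P? b)
greatestUpTo-holds P? P0 zero    = P0
greatestUpTo-holds P? P0 (suc b) with P? (suc b)
... | yes p = p
... | no  _ = greatestUpTo-holds P? P0 b

greatestUpTo-max : (P? : Decidable P) → ∀ b {k} → k ≤ b → P k → k ≤ greatestUpTo P? b
greatestUpTo-max P? zero    k≤b Pk = k≤b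
greatestUpTo-max {P} P? (suc b) {k} k≤b Pk with P? (suc b)
... | yes _ = k≤b
... | no ¬p = greatestUpTo-max P? b (s≤s⁻¹ (≤∧≢⇒< k≤b λ k≡ → ¬p (subst P k≡ Pk))) Pk

leastUpTo-holds : (P? : Decidable P) → ∀ b → P b → P (leastUpTo P? b)
leastUpTo-holds P? zero    Pb = Pb
leastUpTo-holds P? (suc b) Pb with P? zero
... | yes p = p
... | no  _ = leastUpTo-holds (λ k → P? (suc k)) b Pb

leastUpTo-min : (P? : Decidable P) → ∀ b {k} → P k → leastUpTo P? b ≤ k
leastUpTo-min P? zero    Pk = z≤n
leastUpTo-min P? (suc b) {k} Pk with P? zero
... | yes _ = z≤n
leastUpTo-min P? (suc b) {zero}  Pk | no ¬p = ⊥-elim (¬p Pk)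
leastUpTo-min P? (suc b) {suc k} Pk | no ¬p = s≤s (leastUpTo-min (λ j → P? (suc j)) b Pk)

n<p^n : ∀ {p} → 2 ≤ p → ∀ n → n < p ^ n
n<p^n 2≤p zero = z<s
n<p^n {p} 2≤p (suc n) = begin-strict
  suc n           ≤⟨ n<p^n 2≤p n ⟩
  p ^ n           <⟨ m<m+n (p ^ n) (≤-<-trans z≤n (n<p^n 2≤p n)) ⟩
  p ^ n + p ^ n   ≡⟨ cong (p ^ n +_) (+-identityʳ (p ^ n)) ⟨
  2 * p ^ n       ≤⟨ *-monoˡ-≤ (p ^ n) 2≤p ⟩
  p * p ^ n       ∎
  where open ≤-Reasoning

ν-spec : ∀ {p} → 2 ≤ p → ∀ m → .{{_ : NonZero m}} →
         (p ^ ν p m ∣ m) × (∀ k → p ^ k ∣ m → k ≤ ν p m)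
ν-spec {p} 2≤p m =
  greatestUpTo-holds (λ k → (p ^ k) ∣? m) (1∣ m) m ,
  λ k p^k∣m → greatestUpTo-max (λ k → (p ^ k) ∣? m) m
    (<⇒≤ (<-≤-trans (n<p^n 2≤p k) (∣⇒≤ p^k∣m))) p^k∣m

⌊log⌋-spec : ∀ {p} → 2 ≤ p → ∀ m → .{{_ : NonZero m}} →
             (p ^ ⌊log[ p ] m ⌋ ≤ m) × (∀ k → p ^ k ≤ m → k ≤ ⌊log[ p ] m ⌋)
⌊log⌋-spec {p} 2≤p m =
  greatestUpTo-holds (λ k → (p ^ k) ≤? m) (>-nonZero⁻¹ m) m ,
  λ k p^k≤m → greatestUpTo-max (λ k → (p ^ k) ≤? m) m
    (<⇒≤ (<-≤-trans (n<p^n 2≤p k) p^k≤m)) p^k≤m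

⌈log⌉-spec : ∀ {p} → 2 ≤ p → ∀ m →
             (m ≤ p ^ ⌈log[ p ] m ⌉) × (∀ k → m ≤ p ^ k → ⌈log[ p ] m ⌉ ≤ k)
⌈log⌉-spec {p} 2≤p m =
  leastUpTo-holds (λ k → m ≤? (p ^ k)) m (<⇒≤ (n<p^n 2≤p m)) ,
  λ k m≤p^k → leastUpTo-min (λ k → m ≤? (p ^ k)) m m≤p^k

{-# OPTIONS --safe #-}

-- Write V(n) for the p-part of σ(n). For a prime power q^a the number V(q^a)
-- divides σ(q^a), so (q - 1) V(q^a) < q · q^a, which gives
-- ν_p(σ(q^a)) ≤ ⌈log_p q^a⌉, with equality as soon as V(q^a) > q^a. As V is
-- multiplicative, V(n) / n is at most the product of q / (q - 1) over the
-- primes q with V(q^a) > q^a (never q = p, since p ∤ σ(p^a)). Those below p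
-- contribute at most p - 1, because the product of j / (j - 1) over 2 ≤ j ≤ b
-- telescopes to b, and one further prime q > p still leaves the product below
-- p. Hence V(n) < p n.

module Submission where

open import Defs
open import Data.Empty using (⊥-elim)
open import Data.List.Base using (List; []; _∷_; _++_; filter; map; upTo)
open import Data.List.Membership.Propositional using (_∈_)
open import Data.List.Membership.Propositional.Properties
  using (∈-map⁺; ∈-map⁻; ∈-filter⁺; ∈-filter⁻; ∈-upTo⁺; ∈-++⁺ˡ; ∈-++⁺ʳ; ∈-++⁻)
open import Data.List.Membership.Propositional.Properties.WithK using (unique∧set⇒bag)
open import Data.List.Relation.Binary.BagAndSetEquality using (∼bag⇒↭)
open import Data.List.Relation.Binary.Permutation.Propositional using (_↭_)
open import Data.List.Relation.Unary.All using (_∷_)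
open import Data.List.Relation.Unary.Any using (here; there)
open import Data.List.Relation.Unary.Unique.Propositional using (Unique)
import Data.List.Relation.Unary.Unique.Propositional.Properties as Unique
open import Data.Nat.Base
  using (ℕ; zero; suc; _+_; _*_; _∸_; _^_; _/_; _≤_; _<_; z<s; s<s; s≤s⁻¹; s<s⁻¹;
    NonZero; >-nonZero; >-nonZero⁻¹; ≢-nonZero⁻¹; nonTrivial⇒n>1)
open import Data.Nat.Divisibility
open import Data.Nat.DivMod using (m*n/n≡m)
open import Data.Nat.Induction using (<-rec)
open import Data.Nat.ListAction using (sum)
open import Data.Nat.ListAction.Properties using (sum-++; sum-↭)
open import Data.Nat.Primality
  using (Prime; prime?; prime⇒nonZero; prime⇒nonTrivial; prime⇒irreducible; euclidsLemma)
open import Data.Nat.Primality.Factorisation using (factorise)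
open import Data.Nat.Properties
open import Data.Nat.Tactic.RingSolver using (solve-∀)
open import Data.Product using (_×_; _,_; proj₁; proj₂; ∃-syntax; ∃!)
open import Data.Sum.Base using (_⊎_; inj₁; inj₂; [_,_]′)
open import Function.Base using (_∘_)
open import Function.Bundles using (mk⇔)
open import Relation.Binary.PropositionalEquality
  using (_≡_; _≢_; refl; sym; trans; cong; cong₂; subst; subst₂; module ≡-Reasoning)
open import Relation.Nullary using (¬_; yes; no)

private
  variable
    p q r d m n x : ℕ

-- Prime divisors

prime⇒1< : Prime p → 1 < p
prime⇒1< {p} pp = nonTrivial⇒n>1 p {{prime⇒nonTrivial pp}}

prime∣prime⇒≡ : Prime r → Prime q → r ∣ q → r ≡ q
prime∣prime⇒≡ rp qp r∣q with prime⇒irreducible qp r∣q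
... | inj₁ refl = ⊥-elim (<-irrefl refl (prime⇒1< rp))
... | inj₂ r≡q  = r≡q

prime∣^⇒∣ : Prime r → ∀ a → r ∣ q ^ a → r ∣ q
prime∣^⇒∣ rp zero    r∣1 = ⊥-elim (<⇒≢ (prime⇒1< rp) (sym (∣1⇒≡1 r∣1)))
prime∣^⇒∣ {q = q} rp (suc a) r∣ with euclidsLemma q (q ^ a) rp r∣
... | inj₁ r∣q = r∣q
... | inj₂ r∣q^a = prime∣^⇒∣ rp a r∣q^a

∃-prime-divisor : 1 < n → ∃[ q ] Prime q × q ∣ n
∃-prime-divisor {n} 1<n with factorise n {{>-nonZero (<-trans z<s 1<n)}}
... | record { factors = [] ; isFactorisation = n≡1 } = ⊥-elim (<⇒≢ 1<n (sym n≡1))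
... | record { factors = q ∷ qs ; isFactorisation = eq ; factorsPrime = qp ∷ _ } =
  q , qp , subst (q ∣_) (sym eq) (m∣m*n _)

-- Valuations

-- A valuation above `k` would make `p ^ suc k` divide `p ^ k * m`, and cancelling `p ^ k` leaves
-- `p ∣ m`. The evaluations of `ν` below rest on this criterion.
ν-unique : 1 < p → ∀ k → p ∤ m → ν p (p ^ k * m) ≡ k
ν-unique {p} {zero} 1<p k p∤m = ⊥-elim (p∤m (p ∣0))
ν-unique {p} {m@(suc _)} 1<p k p∤m = ≤-antisym (≮⇒≥ k≮ν) (proj₂ spec k (m∣m*n m))
  where
  instance
    p≢0   = >-nonZero (<-trans z<s 1<p)
    p^k≢0 = m^n≢0 p k
    prod≢0 = m*n≢0 (p ^ k) m
  spec = ν-spec 1<p (p ^ k * m)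
  k≮ν : ¬ k < ν p (p ^ k * m)
  k≮ν k<ν = p∤m (*-cancelˡ-∣ (p ^ k)
    (subst (_∣ p ^ k * m) (*-comm p (p ^ k))
      (∣-trans (^-monoʳ-∣ k<ν) (proj₁ spec))))
    where
    ^-monoʳ-∣ : ∀ {i j} → i ≤ j → p ^ i ∣ p ^ j
    ^-monoʳ-∣ {i} {j} i≤j = subst (p ^ i ∣_)
      (trans (sym (^-distribˡ-+-* p i (j ∸ i))) (cong (p ^_) (m+[n∸m]≡n i≤j)))
      (m∣m*n _)

ν-^ : 1 < p → ∀ k → ν p (p ^ k) ≡ k
ν-^ {p} 1<p k = trans (cong (ν p) (sym (*-identityʳ (p ^ k))))
  (ν-unique 1<p k (<⇒≢ 1<p ∘ sym ∘ ∣1⇒≡1))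

∤⇒ν≡0 : 1 < p → p ∤ m → ν p m ≡ 0
∤⇒ν≡0 {p} {m} 1<p p∤m = trans (cong (ν p) (sym (*-identityˡ m))) (ν-unique 1<p 0 p∤m)

-- By maximality of `ν q n`: one more factor `q` in the quotient would give a higher power of `q`
-- dividing `n`.
ν-decompose : 1 < q → ∀ n → .{{_ : NonZero n}} → ∃[ m ] n ≡ q ^ ν q n * m × q ∤ m
ν-decompose {q} 1<q n = quotient q^ν∣n , eq , q∤quotient
  where
  q^ν∣n = proj₁ (ν-spec 1<q n)
  eq = m∣n⇒n≡m*quotient q^ν∣n
  q∤quotient : q ∤ quotient q^ν∣n
  q∤quotient (divides c quotient≡) = <-irrefl refl (proj₂ (ν-spec 1<q n) (suc (ν q n)) (divides c (begin
    n                               ≡⟨ eq ⟩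
    q ^ ν q n * quotient q^ν∣n      ≡⟨ cong (q ^ ν q n *_) quotient≡ ⟩
    q ^ ν q n * (c * q)             ≡⟨ rearrange (q ^ ν q n) c q ⟩
    c * (q * q ^ ν q n)             ∎)))
    where
    open ≡-Reasoning
    rearrange : ∀ t c q → t * (c * q) ≡ c * (q * t)
    rearrange = solve-∀

ν-* : Prime p → ∀ x y → .{{_ : NonZero x}} → .{{_ : NonZero y}} →
      ν p (x * y) ≡ ν p x + ν p y
ν-* {p} pp x y = lemma (ν-decompose 1<p x) (ν-decompose 1<p y)
  where
  1<p = prime⇒1< pp
  open ≡-Reasoning
  interchange : ∀ s a t b → (s * a) * (t * b) ≡ (s * t) * (a * b)
  interchange = solve-∀
  lemma : ∃[ a ] x ≡ p ^ ν p x * a × p ∤ a → ∃[ b ] y ≡ p ^ ν p y * b × p ∤ b →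
          ν p (x * y) ≡ ν p x + ν p y
  lemma (a , x≡ , p∤a) (b , y≡ , p∤b) = begin
    ν p (x * y)                                ≡⟨ cong (ν p) (cong₂ _*_ x≡ y≡) ⟩
    ν p ((p ^ ν p x * a) * (p ^ ν p y * b))    ≡⟨ cong (ν p) (interchange (p ^ ν p x) a _ b) ⟩
    ν p ((p ^ ν p x * p ^ ν p y) * (a * b))    ≡⟨ cong (λ t → ν p (t * (a * b))) (^-distribˡ-+-* p (ν p x) (ν p y)) ⟨
    ν p (p ^ (ν p x + ν p y) * (a * b))        ≡⟨ ν-unique 1<p _ ([ p∤a , p∤b ]′ ∘ euclidsLemma a b pp) ⟩
    ν p x + ν p y                              ∎

ν-cofactor : Prime q → q ∤ m → .{{_ : NonZero m}} → Prime r → r ∣ m → ∀ a →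
             ν r (q ^ a * m) ≡ ν r m
ν-cofactor {q} {m} {r} qp q∤m rp r∣m a = begin
  ν r (q ^ a * m)      ≡⟨ ν-* rp (q ^ a) m ⟩
  ν r (q ^ a) + ν r m  ≡⟨ cong (_+ ν r m) (∤⇒ν≡0 (prime⇒1< rp) r∤q^a) ⟩
  ν r m                ∎
  where
  open ≡-Reasoning
  instance
    q≢0   = prime⇒nonZero qp
    q^a≢0 = m^n≢0 q a
  r∤q^a : r ∤ q ^ a
  r∤q^a r∣ = q∤m (subst (_∣ m) (prime∣prime⇒≡ rp qp (prime∣^⇒∣ rp a r∣)) r∣m)

-- Prepares recursion on the cofactor `m`: it is smaller than `n`, and its primes keep the
-- valuations they have in `n`, so hypotheses about the prime powers of `n` pass to `m`.
primePower-split : Prime q → ∀ n → .{{_ : NonZero n}} → q ∣ n →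
  ∃[ m ] n ≡ q ^ ν q n * m × q ∤ m × NonZero m × m < n ×
         (∀ {r} → Prime r → r ∣ m → r ∣ n × r ≢ q × ν r n ≡ ν r m)
primePower-split {q} qp n q∣n with ν-decompose (prime⇒1< qp) n
... | zero , _ , q∤0 = ⊥-elim (q∤0 (q ∣0))
... | m@(suc _) , n≡ , q∤m = m , n≡ , q∤m , _ , m<n , λ {r} rp r∣m →
      subst (r ∣_) (sym n≡) (∣n⇒∣m*n (q ^ ν q n) r∣m) ,
      (λ r≡q → q∤m (subst (_∣ m) r≡q r∣m)) ,
      trans (cong (ν r) n≡) (ν-cofactor qp q∤m rp r∣m (ν q n))
  where
  m<n : m < n
  m<n = ≤∧≢⇒< (∣⇒≤ (subst (m ∣_) (sym n≡) (n∣m*n (q ^ ν q n))))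
              (λ m≡n → q∤m (subst (q ∣_) (sym m≡n) q∣n))

-- Induction over prime-power factors

-- Strong induction removing one full prime power at a time. The base cases are only the prime
-- powers exactly dividing `n`, so properties special to `n` can be fed in.
primePower-induction : (P : ℕ → Set) → P 1 →
  (∀ q a m → Prime q → q ∤ m → .{{_ : NonZero m}} → P (q ^ a) → P m → P (q ^ a * m)) →
  ∀ n → .{{_ : NonZero n}} → (∀ q → Prime q → q ∣ n → P (q ^ ν q n)) → P n
primePower-induction P P1 P* n {{n≢0}} = <-rec Q step n (>-nonZero⁻¹ n)
  where
  Q : ℕ → Set
  Q n = 0 < n → (∀ q → Prime q → q ∣ n → P (q ^ ν q n)) → P n
  step : ∀ n → (∀ {m} → m < n → Q m) → Q n
  step (suc zero) rec _ h = P1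
  step n@(suc (suc _)) rec _ h =
    let q , qp , q∣n = ∃-prime-divisor (s<s z<s)
        m , n≡ , q∤m , m≢0 , m<n , primes = primePower-split qp n q∣n
    in subst P (sym n≡) (P* q (ν q n) m qp q∤m {{m≢0}} (h q qp q∣n)
         (rec m<n (>-nonZero⁻¹ m {{m≢0}}) λ r rp r∣m →
           let r∣n , _ , νr≡ = primes rp r∣m
           in subst (λ k → P (r ^ k)) νr≡ (h r rp r∣n)))

-- The divisor sum

divisors : ℕ → List ℕ
divisors n = filter (_∣? n) (map suc (upTo n))

∈-divisors⁺ : ∀ n → .{{_ : NonZero n}} → d ∣ n → d ∈ divisors n
∈-divisors⁺ {zero}  n 0∣n = ⊥-elim (≢-nonZero⁻¹ n (0∣⇒≡0 0∣n))
∈-divisors⁺ {suc d} n d∣n = ∈-filter⁺ (_∣? n) (∈-map⁺ suc (∈-upTo⁺ (∣⇒≤ d∣n))) d∣n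

∈-divisors⁻ : ∀ n → d ∈ divisors n → d ∣ n
∈-divisors⁻ n d∈ = proj₂ (∈-filter⁻ (_∣? n) {xs = map suc (upTo n)} d∈)

divisors-unique : ∀ n → Unique (divisors n)
divisors-unique n = Unique.filter⁺ (_∣? n) (Unique.map⁺ suc-injective (Unique.upTo⁺ n))

-- A divisor of q^(a+1) m is either prime to q, hence a divisor of m, or q
-- times a divisor of q^a m.
divisors-primePower : Prime q → q ∤ m → .{{_ : NonZero m}} → ∀ a →
  -- Both lists are free of duplicates, so having the same members makes them permutations of each
  -- other.
  divisors (q ^ suc a * m) ↭ divisors m ++ map (q *_) (divisors (q ^ a * m))
divisors-primePower {q} {m} qp q∤m a = ∼bag⇒↭ (unique∧set⇒bag
  (divisors-unique (q ^ suc a * m))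
  (Unique.++⁺ (divisors-unique m) (Unique.map⁺ (*-cancelˡ-≡ _ _ q) (divisors-unique (q ^ a * m))) disjoint)
  (mk⇔ to from))
  where
  instance
    q≢0    = prime⇒nonZero qp
    q^a≢0  = m^n≢0 q a
    q^sa≢0 = m^n≢0 q (suc a)
    lo≢0   = m*n≢0 (q ^ a) m
    hi≢0   = m*n≢0 (q ^ suc a) m
  disjoint : ∀ {d} → ¬ (d ∈ divisors m × d ∈ map (q *_) (divisors (q ^ a * m)))
  disjoint (d∈ , d∈′) with ∈-map⁻ (q *_) d∈′
  ... | e , _ , refl = q∤m (∣-trans (m∣m*n e) (∈-divisors⁻ m d∈))
  -- In `q * (q ^ b * m) ≡ c * d` Euclid's lemma forces `q ∣ c`, so one factor `q` cancels on both
  -- sides.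
  cancel : ∀ {d} → q ∤ d → ∀ b → d ∣ q ^ b * m → d ∣ m
  cancel {d} q∤d zero    d∣ = subst (d ∣_) (*-identityˡ m) d∣
  cancel {d} q∤d (suc b) (divides c eq) with euclidsLemma c d qp
    (subst (q ∣_) (trans (sym (*-assoc q (q ^ b) m)) eq) (m∣m*n _))
  ... | inj₂ q∣d = ⊥-elim (q∤d q∣d)
  ... | inj₁ (divides c′ refl) = cancel q∤d b (divides c′ (*-cancelˡ-≡ _ _ q (begin
    q * (q ^ b * m)   ≡⟨ *-assoc q (q ^ b) m ⟨
    q * q ^ b * m     ≡⟨ eq ⟩
    c′ * q * d        ≡⟨ cong (_* d) (*-comm c′ q) ⟩
    q * c′ * d        ≡⟨ *-assoc q c′ d ⟩
    q * (c′ * d)      ∎)))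
    where open ≡-Reasoning
  to : ∀ {d} → d ∈ divisors (q ^ suc a * m) →
       d ∈ divisors m ++ map (q *_) (divisors (q ^ a * m))
  to {d} d∈ with q ∣? d
  ... | no q∤d = ∈-++⁺ˡ (∈-divisors⁺ m (cancel q∤d (suc a) (∈-divisors⁻ _ d∈)))
  ... | yes (divides e refl) = ∈-++⁺ʳ (divisors m)
    (subst (_∈ map (q *_) (divisors (q ^ a * m))) (*-comm q e)
      (∈-map⁺ (q *_) (∈-divisors⁺ (q ^ a * m)
        (*-cancelˡ-∣ q (subst₂ _∣_ (*-comm e q) (*-assoc q (q ^ a) m) (∈-divisors⁻ _ d∈))))))
  from : ∀ {d} → d ∈ divisors m ++ map (q *_) (divisors (q ^ a * m)) →
         d ∈ divisors (q ^ suc a * m)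
  from d∈ with ∈-++⁻ (divisors m) d∈
  ... | inj₁ d∈m = ∈-divisors⁺ _ (∣n⇒∣m*n (q ^ suc a) (∈-divisors⁻ m d∈m))
  ... | inj₂ d∈′ with ∈-map⁻ (q *_) d∈′
  ... | e , e∈ , refl = ∈-divisors⁺ _
    (subst (q * e ∣_) (sym (*-assoc q (q ^ a) m)) (*-monoʳ-∣ q (∈-divisors⁻ _ e∈)))

sum-map-* : ∀ c xs → sum (map (c *_) xs) ≡ c * sum xs
sum-map-* c []       = sym (*-zeroʳ c)
sum-map-* c (x ∷ xs) = trans (cong (c * x +_) (sum-map-* c xs)) (sym (*-distribˡ-+ c x (sum xs)))

σ-step : Prime q → q ∤ m → .{{_ : NonZero m}} → ∀ a →
         σ (q ^ suc a * m) ≡ σ m + q * σ (q ^ a * m)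
σ-step {q} {m} qp q∤m a = begin
  sum (divisors (q ^ suc a * m))                              ≡⟨ sum-↭ (divisors-primePower qp q∤m a) ⟩
  sum (divisors m ++ map (q *_) (divisors (q ^ a * m)))       ≡⟨ sum-++ (divisors m) _ ⟩
  σ m + sum (map (q *_) (divisors (q ^ a * m)))               ≡⟨ cong (σ m +_) (sum-map-* q (divisors (q ^ a * m))) ⟩
  σ m + q * σ (q ^ a * m)                                     ∎
  where open ≡-Reasoning

σ-^suc : Prime q → ∀ a → σ (q ^ suc a) ≡ 1 + q * σ (q ^ a)
σ-^suc {q} qp a = subst₂ (λ u v → σ u ≡ 1 + q * σ v) (*-identityʳ (q ^ suc a)) (*-identityʳ (q ^ a))
  (σ-step qp (<⇒≢ (prime⇒1< qp) ∘ sym ∘ ∣1⇒≡1) a)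

-- As functions of `a`, both sides start at `σ m` and satisfy the recurrence sending `t` to
-- `σ m + q * t`.
σ-primePower-* : Prime q → q ∤ m → .{{_ : NonZero m}} → ∀ a →
                 σ (q ^ a * m) ≡ σ (q ^ a) * σ m
σ-primePower-* {q} {m} qp q∤m zero    = trans (cong σ (*-identityˡ m)) (sym (*-identityˡ (σ m)))
σ-primePower-* {q} {m} qp q∤m (suc a) = begin
  σ (q ^ suc a * m)              ≡⟨ σ-step qp q∤m a ⟩
  σ m + q * σ (q ^ a * m)        ≡⟨ cong (λ t → σ m + q * t) (σ-primePower-* qp q∤m a) ⟩
  σ m + q * (σ (q ^ a) * σ m)    ≡⟨ cong (σ m +_) (*-assoc q (σ (q ^ a)) (σ m)) ⟨
  (1 + q * σ (q ^ a)) * σ m      ≡⟨ cong (_* σ m) (σ-^suc qp a) ⟨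
  σ (q ^ suc a) * σ m            ∎
  where open ≡-Reasoning

-- The geometric sum, with the 1 moved to the left so that the power is free of truncated
-- subtraction.
σ-geometric : Prime q → ∀ a → σ (q ^ a) * (q ∸ 1) + 1 ≡ q ^ suc a
σ-geometric {zero}  qp = ⊥-elim (n≮0 (prime⇒1< qp))
σ-geometric {suc c} qp zero    = base c
  where
  base : ∀ c → 1 * c + 1 ≡ (1 + c) * 1
  base = solve-∀
σ-geometric {suc c} qp (suc a) = begin
  σ (suc c ^ suc a) * c + 1           ≡⟨ cong (λ t → t * c + 1) (σ-^suc qp a) ⟩
  (1 + suc c * σ (suc c ^ a)) * c + 1 ≡⟨ rearrange c (σ (suc c ^ a)) ⟩
  suc c * (σ (suc c ^ a) * c + 1)     ≡⟨ cong (suc c *_) (σ-geometric qp a) ⟩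
  suc c ^ suc (suc a)                 ∎
  where
  open ≡-Reasoning
  rearrange : ∀ c s → (1 + (1 + c) * s) * c + 1 ≡ (1 + c) * (s * c + 1)
  rearrange = solve-∀

∈⇒≤sum : ∀ {xs} → x ∈ xs → x ≤ sum xs
∈⇒≤sum (here refl) = m≤m+n _ _
∈⇒≤sum {xs = z ∷ _} (there x∈xs) = ≤-trans (∈⇒≤sum x∈xs) (m≤n+m _ z)

n≤σn : ∀ n → .{{_ : NonZero n}} → n ≤ σ n
n≤σn n = ∈⇒≤sum (∈-divisors⁺ n ∣-refl)

σ≢0 : ∀ n → .{{_ : NonZero n}} → NonZero (σ n)
σ≢0 n = >-nonZero (<-≤-trans (>-nonZero⁻¹ n) (n≤σn n))

-- The p-part of σ

V : ℕ → ℕ → ℕ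
V p n = p ^ ν p (σ n)

V-* : Prime p → Prime q → q ∤ m → .{{_ : NonZero m}} → ∀ a →
      V p (q ^ a * m) ≡ V p (q ^ a) * V p m
V-* {p} {q} {m} pp qp q∤m a = begin
  p ^ ν p (σ (q ^ a * m))                  ≡⟨ cong (λ t → p ^ ν p t) (σ-primePower-* qp q∤m a) ⟩
  p ^ ν p (σ (q ^ a) * σ m)                ≡⟨ cong (p ^_) (ν-* pp (σ (q ^ a)) (σ m)) ⟩
  p ^ (ν p (σ (q ^ a)) + ν p (σ m))        ≡⟨ ^-distribˡ-+-* p (ν p (σ (q ^ a))) _ ⟩
  V p (q ^ a) * V p m                      ∎
  where
  open ≡-Reasoning
  instance
    q≢0   = prime⇒nonZero qp
    q^a≢0 = m^n≢0 q a
    σqa≢0 = σ≢0 (q ^ a)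
    σm≢0  = σ≢0 m

-- The bound V(q^a) / q^a < q / (q - 1), cleared of denominators.
V-primePower : 1 < p → Prime q → ∀ a → V p (q ^ a) * (q ∸ 1) < q * q ^ a
V-primePower {p} {q} 1<p qp a = begin-strict
  V p (q ^ a) * (q ∸ 1)      ≤⟨ *-monoˡ-≤ (q ∸ 1) (∣⇒≤ (proj₁ (ν-spec 1<p (σ (q ^ a))))) ⟩
  σ (q ^ a) * (q ∸ 1)        <⟨ m<m+n _ z<s ⟩
  σ (q ^ a) * (q ∸ 1) + 1    ≡⟨ σ-geometric qp a ⟩
  q * q ^ a                  ∎
  where
  open ≤-Reasoning
  instance
    q≢0   = prime⇒nonZero qp
    q^a≢0 = m^n≢0 q a
    σqa≢0 = σ≢0 (q ^ a)

-- With c the ceiling, `n` is at most p^c, so V(m) < p^(c+1); comparing exponents gives the claim.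
V<p*n⇒ν≤⌈log⌉ : 1 < p → V p m < p * n → ν p (σ m) ≤ ⌈log[ p ] n ⌉
V<p*n⇒ν≤⌈log⌉ {p} {m} {n} 1<p V<pn = ≮⇒≥ λ ceil<ν → <-irrefl refl (begin-strict
  V p m                       <⟨ V<pn ⟩
  p * n                       ≤⟨ *-monoʳ-≤ p (proj₁ (⌈log⌉-spec 1<p n)) ⟩
  p ^ suc ⌈log[ p ] n ⌉       ≤⟨ ^-monoʳ-≤ p ceil<ν ⟩
  V p m                       ∎)
  where
  open ≤-Reasoning
  instance p≢0 = >-nonZero (<-trans z<s 1<p)

-- The ratio q / (q - 1) is at most 2, hence at most `p`.
V-primePower<p* : 2 < p → Prime q → ∀ a → V p (q ^ a) < p * q ^ a
V-primePower<p* {p} {zero} 2<p qp a = ⊥-elim (n≮0 (prime⇒1< qp))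
V-primePower<p* {p} {suc zero} 2<p qp a = ⊥-elim (<-irrefl refl (prime⇒1< qp))
V-primePower<p* {p} {q@(suc (suc c))} 2<p qp a = *-cancelʳ-< (suc c) _ _ (begin-strict
  V p (q ^ a) * suc c           <⟨ V-primePower (<-trans (s<s z<s) 2<p) qp a ⟩
  q * q ^ a                     ≤⟨ *-monoˡ-≤ (q ^ a) q≤ ⟩
  p * suc c * q ^ a             ≡⟨ rearrange p (suc c) (q ^ a) ⟩
  p * q ^ a * suc c             ∎)
  where
  open ≤-Reasoning
  rearrange : ∀ p c t → p * c * t ≡ p * t * c
  rearrange = solve-∀
  q≤ : q ≤ p * suc c
  q≤ = begin
    2 + c             ≤⟨ +-monoʳ-≤ 2 (m≤n*m c 2) ⟩
    2 + 2 * c         ≡⟨ *-suc 2 c ⟨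
    2 * suc c         ≤⟨ *-monoˡ-≤ (suc c) (<⇒≤ 2<p) ⟩
    p * suc c         ∎

-- Exceptional primes

-- These are the primes contributing a factor above 1 to V(n) / n. Each of the three conditions of
-- the theorem is used as a restriction on them.
Exceptional : ℕ → ℕ → ℕ → Set
Exceptional p n q = q ^ ν q n < V p (q ^ ν q n)

-- The p-part lies strictly between q^a and p q^a, which pins its exponent to the ceiling.
exceptional⇒≡⌈log⌉ : 2 < p → Prime q → Exceptional p n q →
                     ν p (σ (q ^ ν q n)) ≡ ⌈log[ p ] (q ^ ν q n) ⌉
exceptional⇒≡⌈log⌉ {p} {q} {n} 2<p qp exc = ≤-antisym
  (V<p*n⇒ν≤⌈log⌉ {m = q ^ ν q n} 1<p (V-primePower<p* 2<p qp (ν q n)))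
  (proj₂ (⌈log⌉-spec 1<p (q ^ ν q n)) _ (<⇒≤ exc))
  where 1<p = <-trans (s<s z<s) 2<p

-- Since `σ (p ^ a)` is 1 modulo `p`, its p-part is 1.
exceptional⇒≢ : Prime p → Exceptional p n q → q ≢ p
exceptional⇒≢ {p} {n} pp exc refl = <⇒≱ exc (begin
  p ^ ν p (σ (p ^ ν p n))   ≡⟨ cong (p ^_) (∤⇒ν≡0 1<p (p∤σ (ν p n))) ⟩
  1                         ≤⟨ m^n>0 p (ν p n) ⟩
  p ^ ν p n                 ∎)
  where
  open ≤-Reasoning
  instance p≢0 = prime⇒nonZero pp
  1<p = prime⇒1< pp
  p∤1 : p ∤ 1
  p∤1 = <⇒≢ 1<p ∘ sym ∘ ∣1⇒≡1
  p∤σ : ∀ a → p ∤ σ (p ^ a)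
  p∤σ zero    = p∤1
  p∤σ (suc a) p∣ = p∤1 (∣m+n∣m⇒∣n
    (subst (p ∣_) (trans (σ-^suc pp a) (+-comm 1 _)) p∣) (m∣m*n (σ (p ^ a))))

-- Bounds on V(n) / n

V≤n : Prime p → ∀ n → .{{_ : NonZero n}} →
      (∀ q → Prime q → q ∣ n → ¬ Exceptional p n q) → V p n ≤ n
V≤n {p} pp n none = primePower-induction (λ n → V p n ≤ n)
  (≤-reflexive (cong (p ^_) (ν-^ (prime⇒1< pp) 0)))
  (λ q a m qp q∤m Vq≤ Vm≤ → subst (_≤ q ^ a * m) (sym (V-* pp qp q∤m a)) (*-mono-≤ Vq≤ Vm≤))
  n λ q qp q∣n → ≮⇒≥ (none q qp q∣n)

-- Splitting off an exceptional prime q from n costs a factor q / (q - 1).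
V-split : Prime p → Prime q → ∀ n → .{{_ : NonZero n}} → q ∣ n → ∀ c →
  (∀ m → .{{_ : NonZero m}} →
    (∀ r → Prime r → r ∣ m → Exceptional p m r → r ∣ n × r ≢ q × Exceptional p n r) →
    V p m ≤ c * m) →
  V p n * (q ∸ 1) ≤ c * q * n
V-split {p} {q} pp qp n q∣n c bound = lemma (primePower-split qp n q∣n)
  where
  open ≤-Reasoning
  rearrange₁ : ∀ x y t → x * y * t ≡ x * t * y
  rearrange₁ = solve-∀
  rearrange₂ : ∀ q t c m → q * t * (c * m) ≡ c * q * (t * m)
  rearrange₂ = solve-∀
  lemma : _ → V p n * (q ∸ 1) ≤ c * q * n
  lemma (m , n≡ , q∤m , m≢0 , _ , primes) = begin
    V p n * (q ∸ 1)                        ≡⟨ cong (λ t → V p t * (q ∸ 1)) n≡ ⟩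
    V p (q ^ ν q n * m) * (q ∸ 1)          ≡⟨ cong (_* (q ∸ 1)) (V-* pp qp q∤m {{m≢0}} (ν q n)) ⟩
    V p (q ^ ν q n) * V p m * (q ∸ 1)      ≡⟨ rearrange₁ (V p (q ^ ν q n)) _ _ ⟩
    V p (q ^ ν q n) * (q ∸ 1) * V p m      ≤⟨ *-mono-≤ (<⇒≤ (V-primePower (prime⇒1< pp) qp (ν q n))) (bound m {{m≢0}} inherit) ⟩
    q * q ^ ν q n * (c * m)                ≡⟨ rearrange₂ q (q ^ ν q n) c m ⟩
    c * q * (q ^ ν q n * m)                ≡⟨ cong (c * q *_) n≡ ⟨
    c * q * n                              ∎
    where
    -- Exceptionality depends only on the valuation of `r`, which is the same in `m` and `n`.
    inherit : ∀ r → Prime r → r ∣ m → Exceptional p m r → r ∣ n × r ≢ q × Exceptional p n r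
    inherit r rp r∣m exc =
      let r∣n , r≢q , νr≡ = primes rp r∣m
      in r∣n , r≢q , subst (λ k → r ^ k < V p (r ^ k)) (sym νr≡) exc

-- Induction on `b`, testing the candidate b + 2. If it is a prime divisor of `n` it is split off;
-- otherwise the bound for `b` already applies and is weakened.
V≤b*n : Prime p → ∀ b n → .{{_ : NonZero n}} →
        (∀ q → Prime q → q ∣ n → Exceptional p n q → q ≤ suc b) → V p n ≤ suc b * n
V≤b*n pp zero n small = subst (V _ n ≤_) (sym (*-identityˡ n)) (V≤n pp n
  λ q qp q∣n exc → <⇒≱ (prime⇒1< qp) (small q qp q∣n exc))
V≤b*n {p} pp (suc b) n small with prime? (suc (suc b)) | suc (suc b) ∣? n
-- The telescoping step: with q = b + 2 the bound b + 1 on the cofactor is multiplied by q / (q - 1)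
-- = (b + 2) / (b + 1).
... | yes qp | yes q∣n = *-cancelʳ-≤ _ _ (suc b) (begin
    V p n * suc b                 ≤⟨ V-split pp qp n q∣n (suc b) (λ m smaller → V≤b*n pp b m
                                       λ r rp r∣m exc → let r∣n , r≢q , exc′ = smaller r rp r∣m exc
                                         in s≤s⁻¹ (≤∧≢⇒< (small r rp r∣n exc′) r≢q)) ⟩
    suc b * suc (suc b) * n       ≡⟨ rearrange (suc b) (suc (suc b)) n ⟩
    suc (suc b) * n * suc b       ∎)
  where
  open ≤-Reasoning
  rearrange : ∀ x y n → x * y * n ≡ y * n * x
  rearrange = solve-∀
... | no ¬qp | _ = ≤-trans (V≤b*n pp b n λ q qp q∣n exc →
        s≤s⁻¹ (≤∧≢⇒< (small q qp q∣n exc) λ { refl → ¬qp qp }))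
      (*-monoˡ-≤ n (n≤1+n (suc b)))
... | yes _ | no q∤n = ≤-trans (V≤b*n pp b n λ q qp q∣n exc →
        s≤s⁻¹ (≤∧≢⇒< (small q qp q∣n exc) λ { refl → q∤n q∣n }))
      (*-monoˡ-≤ n (n≤1+n (suc b)))

V≤[p∸1]*n : Prime p → ∀ n → .{{_ : NonZero n}} →
  (∀ q → Prime q → q ∣ n → Exceptional p n q → q < p) → V p n ≤ (p ∸ 1) * n
V≤[p∸1]*n {zero} pp = ⊥-elim (n≮0 (prime⇒1< pp))
V≤[p∸1]*n {suc zero} pp = ⊥-elim (<-irrefl refl (prime⇒1< pp))
V≤[p∸1]*n {suc (suc b)} pp n small =
  V≤b*n pp b n λ q qp q∣n exc → s≤s⁻¹ (small q qp q∣n exc)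

V<p*n-below : Prime p → ∀ n → .{{_ : NonZero n}} →
  (∀ q → Prime q → q ∣ n → Exceptional p n q → q < p) → V p n < p * n
V<p*n-below {p} pp n small = ≤-<-trans (V≤[p∸1]*n pp n small)
  (*-monoˡ-< n (∸-monoʳ-< z<s (<⇒≤ (prime⇒1< pp))))

-- Splitting off `q` leaves a cofactor with bound p - 1, and (p - 1) q / (q - 1) < p precisely
-- because p < q.
V<p*n-oneAbove : Prime p → Prime q → p < q → ∀ n → .{{_ : NonZero n}} → q ∣ n →
  (∀ r → Prime r → r ∣ n → r ≢ q → Exceptional p n r → r < p) → V p n < p * n
V<p*n-oneAbove {zero} pp = ⊥-elim (n≮0 (prime⇒1< pp))
V<p*n-oneAbove {suc b} {suc c} pp qp p<q n q∣n small = *-cancelʳ-< c _ _ (begin-strict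
  V (suc b) n * c      ≤⟨ V-split pp qp n q∣n b (λ m smaller → V≤[p∸1]*n pp m
                            λ r rp r∣m exc → let r∣n , r≢q , exc′ = smaller r rp r∣m exc
                              in small r rp r∣n r≢q exc′) ⟩
  b * suc c * n        <⟨ *-monoˡ-< n b[c+1]<[b+1]c ⟩
  suc b * c * n        ≡⟨ rearrange (suc b) c n ⟩
  suc b * n * c        ∎)
  where
  open ≤-Reasoning
  rearrange : ∀ x y n → x * y * n ≡ x * n * y
  rearrange = solve-∀
  b[c+1]<[b+1]c : b * suc c < suc b * c
  b[c+1]<[b+1]c = begin-strict
    b * suc c   ≡⟨ *-suc b c ⟩
    b + b * c   <⟨ +-monoˡ-< (b * c) (s<s⁻¹ p<q) ⟩
    c + b * c   ∎

-- The equality case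

-- The quotient in the equation is `σ (q ^ k)`, by the geometric sum.
ljunggrenNagell⇒σ≡ : ∀ p (qp : Prime q) k s → LjunggrenNagell p q k s qp → σ (q ^ k) ≡ p ^ s
ljunggrenNagell⇒σ≡ {q} p qp k s ln = trans (sym (m*n/n≡m (σ (q ^ k)) (q ∸ 1))) (trans
  (cong (λ t → t / (q ∸ 1)) (sym (begin
    q ^ suc k ∸ 1                          ≡⟨ cong (_∸ 1) (σ-geometric qp k) ⟨
    σ (q ^ k) * (q ∸ 1) + 1 ∸ 1            ≡⟨ m+n∸n≡m _ 1 ⟩
    σ (q ^ k) * (q ∸ 1)                    ∎))) ln)
  where
  open ≡-Reasoning
  instance
    q∸1≢0 : NonZero (q ∸ 1)
    q∸1≢0 = >-nonZero (m<n⇒0<n∸m (prime⇒1< qp))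

σ-primePowers⇒σ-power : ∀ p n → .{{_ : NonZero n}} →
  (∀ q → Prime q → q ∣ n → ∃[ s ] σ (q ^ ν q n) ≡ p ^ s) → ∃[ t ] σ n ≡ p ^ t
σ-primePowers⇒σ-power p = primePower-induction (λ n → ∃[ t ] σ n ≡ p ^ t) (0 , refl)
  λ { q a m qp q∤m (s , σq≡) (t , σm≡) → s + t ,
      trans (σ-primePower-* qp q∤m a) (trans (cong₂ _*_ σq≡ σm≡) (sym (^-distribˡ-+-* p s t))) }

-- Here n ≤ σ(n) = p^t, and t is the full valuation of σ(n).
⌈log⌉≤ν-of-power : 1 < p → ∀ n → .{{_ : NonZero n}} →
  ∃[ t ] σ n ≡ p ^ t → ⌈log[ p ] n ⌉ ≤ ν p (σ n)
⌈log⌉≤ν-of-power {p} 1<p n (t , σn≡) = begin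
  ⌈log[ p ] n ⌉   ≤⟨ proj₂ (⌈log⌉-spec 1<p n) t (subst (n ≤_) σn≡ (n≤σn n)) ⟩
  t               ≡⟨ ν-^ 1<p t ⟨
  ν p (p ^ t)     ≡⟨ cong (ν p) σn≡ ⟨
  ν p (σ n)       ∎
  where open ≤-Reasoning

-- In the equality clause the exponent k is tied to `ν q n`. With k free equality can fail: for p =
-- 3, n = 4 the prime 2 satisfies (2^2 - 1) / (2 - 1) = 3, yet σ(4) = 7 is prime to 3.
theorem1p4 : ∀ (p n : ℕ) → Prime p → 2 < p → .{{_ : NonZero n}} →
    ( (∀ q → Prime q → q ∣ n →
    ν p (σ (q ^ ν q n)) ≤ ⌊log[ p ] (q ^ ν q n) ⌋)
    ⊎ (∀ q → Prime q → q ∣ n →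
    ν p (σ (q ^ ν q n)) ≡ ⌈log[ p ] (q ^ ν q n) ⌉ → q < p)
    ⊎ ∃! _≡_ (λ q → Prime q × p < q × q ∣ n ×
    ν p (σ (q ^ ν q n)) ≡ ⌈log[ p ] (q ^ ν q n) ⌉) ) →
    ν p (σ n) ≤ ⌈log[ p ] n ⌉
    × ((∀ q → (q-prime : Prime q) → q ∣ n →
    ∃[ s ] LjunggrenNagell p q (ν q n) s q-prime) →
    ν p (σ n) ≡ ⌈log[ p ] n ⌉)
theorem1p4 p n pp 2<p hyp = upper , λ ln → ≤-antisym upper (⌈log⌉≤ν-of-power 1<p n
    (σ-primePowers⇒σ-power p n λ q qp q∣n →
      let s , eq = ln q qp q∣n in s , ljunggrenNagell⇒σ≡ p qp (ν q n) s eq))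
  where
  1<p = prime⇒1< pp
  instance p≢0 = prime⇒nonZero pp

  V<p*n : _ → V p n < p * n
  -- The floor bound gives V(q^a) ≤ q^a, so no prime is exceptional.
  V<p*n (inj₁ floors) = V<p*n-below pp n λ q qp q∣n exc →
    let instance q^a≢0 = m^n≢0 q (ν q n) {{prime⇒nonZero qp}}
    in ⊥-elim (<⇒≱ exc (≤-trans (^-monoʳ-≤ p (floors q qp q∣n))
         (proj₁ (⌊log⌋-spec 1<p (q ^ ν q n)))))
  V<p*n (inj₂ (inj₁ below)) = V<p*n-below pp n λ q qp q∣n exc →
    below q qp q∣n (exceptional⇒≡⌈log⌉ {n = n} 2<p qp exc)
  -- An exceptional `r` above `p` attains the ceiling and so equals `q` by uniqueness; any other is
  -- at most `p` and differs from `p`.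
  V<p*n (inj₂ (inj₂ (q , (qp , p<q , q∣n , _) , only))) =
    V<p*n-oneAbove pp qp p<q n q∣n λ r rp r∣n r≢q exc →
      ≤∧≢⇒< (≮⇒≥ λ p<r → r≢q (sym (only (rp , p<r , r∣n , exceptional⇒≡⌈log⌉ {n = n} 2<p rp exc))))
            (exceptional⇒≢ {n = n} pp exc)

  upper : ν p (σ n) ≤ ⌈log[ p ] n ⌉
  upper = V<p*n⇒ν≤⌈log⌉ {m = n} 1<p (V<p*n hyp)
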